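{- Let $\mathfrak{A}$ be a complete atomic weakly associative relation algebra with universe $A$, and let $\mathfrak{B}=\langle B,T_\kappa,E_{\kappa\lambda}\rangle_{\kappa,\lambda<3}$ be its suitable structure. Then $\mathfrak{A}\cong\mathfrak{Ra}\,\mathfrak{Cm}\,\mathfrak{B}$, via the map $\varphi:A\to\mathcal{P}(B)$ defined by $\varphi(x)=\{t\in B: t_2\le x\}$.
   Context: WA: algebras $\langle A,+,\overline{\phantom{x}},;,\breve{\phantom{x}},1'\rangle$ with $x\cdot y=\overline{\overline{x}+\overline{y}}$, $0'=\overline{1'}$, $1=1'+0'$, $0=\overline{1}$, satisfying for all $x,y,z$: $x+y=y+x$; $x+(y+z)=(x+y)+z$; $\overline{\overline{x}+\overline{y}}+\overline{\overline{x}+y}=x$; $((x\cdot 1');1);1=(x\cdot1');1$; $(x+y);z=x;z+y;z$; $x;1'=x$; $\breve{\breve{x}}=x$; $\breve{(x+y)}=\breve{x}+\breve{y}$; $\breve{(x;y)}=\breve{y};\breve{x}$; $\breve{x};\overline{x;y}+\overline{y}=\overline{y}$. Complete/atomic refer to the Boolean reduct; $\mathrm{At}(\mathfrak{A})$ = atoms. Suitable structure: $B=\{s\in{}^3\mathrm{At}(\mathfrak{A}): s_2;s_0\ge s_1\}$; $T_\kappa=\{\langle s,t\rangle\in B\times B:s_\kappa=t_\kappa\}$; $E_{\kappa\kappa}=B$; for distinct $\kappa,\lambda$ with third index $\mu$, $E_{\kappa\lambda}=\{s\in B:s_\mu\le1'\}$. Complex algebra $\mathfrak{Cm}\,\mathfrak{B}=\langle\mathcal{P}(B),\cup,\cap,B\setminus\cdot,\emptyset,B,T_\kappa^*,E_{\kappa\lambda}\rangle_{\kappa,\lambda<3}$,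 with $T_\kappa^*(X)=\{y\in B:\exists x\in X\ \langle y,x\rangle\in T_\kappa\}$ as cylindrification $c_\kappa$ and $E_{\kappa\lambda}$ as diagonal $d_{\kappa\lambda}$. Relation-algebraic reduct: for an algebra $\mathfrak{C}=\langle C,+,\overline{\phantom{x}},c_\kappa,d_{\kappa\lambda}\rangle_{\kappa,\lambda<3}$, let $Nr_2\mathfrak{C}=\{x\in C:c_2x=x\}$, $x;y=c_2(c_1(d_{12}\cdot x)\cdot c_0(d_{02}\cdot y))$, $\breve{x}=c_2(d_{20}\cdot c_0(d_{01}\cdot c_1(d_{12}\cdot x)))$, and $\mathfrak{Ra}\,\mathfrak{C}=\langle Nr_2\mathfrak{C},+,\overline{\phantom{x}},;,\breve{\phantom{x}},d_{01}\rangle$. -}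

module Defs where

open import Level using (Level; _⊔_; suc)
open import Algebra.Core using (Op₁; Op₂)
open import Algebra.Definitions using (Congruent₁; Congruent₂)
import Algebra.Morphism.Definitions as MorphismDefinitions
open import Data.Empty.Polymorphic using (⊥)
open import Data.Fin.Base using (Fin)
open import Data.Fin.Patterns using (0F; 1F; 2F)
open import Data.Product.Base using (Σ; ∃; _×_; _,_)
open import Data.Sum.Base using (_⊎_; map)
open import Data.Unit.Polymorphic using (⊤)
open import Function.Definitions using (Injective; Surjective)
open import Relation.Binary.Bundles using (Setoid)
open import Relation.Binary.Core using (Rel)
open import Relation.Binary.Definitions using (_Respects_; _Respects₂_)
open import Relation.Binary.Morphism.Structures using (IsRelHomomorphism)
open import Relation.Binary.Structures using (IsEquivalence)
open import Relation.Nullary.Negation.Core using (¬_)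
open import Relation.Unary using (Pred; _∈_; _≐_)

record RawRelationAlgebra c ℓ : Set (suc (c ⊔ ℓ)) where
  infix  9 _⁻ _˘
  infixl 8 _⨾_
  infixl 7 _·_
  infixl 6 _+_
  infix  4 _≈_ _≤_
  field
    Carrier : Set c
    _≈_     : Rel Carrier ℓ
    _+_     : Op₂ Carrier
    _⁻      : Op₁ Carrier
    _⨾_     : Op₂ Carrier
    _˘      : Op₁ Carrier
    1'      : Carrier

  _·_ : Op₂ Carrier
  x · y = (x ⁻ + y ⁻) ⁻

  0' 1# 0# : Carrier
  0' = 1' ⁻
  1# = 1' + 0'
  0# = 1# ⁻

  _≤_ : Rel Carrier ℓ
  x ≤ y = x + y ≈ y

  IsAtom : Pred Carrier (c ⊔ ℓ)
  IsAtom a = ¬ (a ≈ 0#) × (∀ x → x ≤ a → x ≈ 0# ⊎ x ≈ a)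

  IsLUB : ∀ {p} → Pred Carrier p → Pred Carrier (c ⊔ ℓ ⊔ p)
  IsLUB S u = (∀ x → x ∈ S → x ≤ u) × (∀ v → (∀ x → x ∈ S → x ≤ v) → u ≤ v)

  IsComplete : ∀ p → Set (c ⊔ ℓ ⊔ suc p)
  IsComplete p = (S : Pred Carrier p) → ∃ λ u → IsLUB S u

  IsAtomic : Set (c ⊔ ℓ)
  IsAtomic = ∀ x → ¬ (x ≈ 0#) → ∃ λ a → IsAtom a × a ≤ x

record IsWA {c ℓ} (𝔄 : RawRelationAlgebra c ℓ) : Set (c ⊔ ℓ) where
  open RawRelationAlgebra 𝔄
  field
    isEquivalence : IsEquivalence _≈_
    +-cong        : Congruent₂ _≈_ _+_
    ⁻-cong        : Congruent₁ _≈_ _⁻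
    ⨾-cong        : Congruent₂ _≈_ _⨾_
    ˘-cong        : Congruent₁ _≈_ _˘

    +-comm        : ∀ x y → x + y ≈ y + x
    +-assoc       : ∀ x y z → x + (y + z) ≈ (x + y) + z
    huntington    : ∀ x y → (x ⁻ + y ⁻) ⁻ + (x ⁻ + y) ⁻ ≈ x
    weak-assoc    : ∀ x → ((x · 1') ⨾ 1#) ⨾ 1# ≈ (x · 1') ⨾ 1#
    ⨾-distribʳ-+  : ∀ x y z → (x + y) ⨾ z ≈ x ⨾ z + y ⨾ z
    ⨾-identityʳ   : ∀ x → x ⨾ 1' ≈ x
    ˘-involutive  : ∀ x → x ˘ ˘ ≈ x
    ˘-+           : ∀ x y → (x + y) ˘ ≈ x ˘ + y ˘
    ˘-⨾           : ∀ x y → (x ⨾ y) ˘ ≈ y ˘ ⨾ x ˘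
    tarski        : ∀ x y → x ˘ ⨾ (x ⨾ y) ⁻ + y ⁻ ≈ y ⁻

record WA c ℓ : Set (suc (c ⊔ ℓ)) where
  field
    raw  : RawRelationAlgebra c ℓ
    isWA : IsWA raw
  open RawRelationAlgebra raw public
  open IsWA isWA public

record IsIsomorphism {c₁ ℓ₁ c₂ ℓ₂}
  (𝔄 : RawRelationAlgebra c₁ ℓ₁) (𝔄′ : RawRelationAlgebra c₂ ℓ₂)
  (f : RawRelationAlgebra.Carrier 𝔄 → RawRelationAlgebra.Carrier 𝔄′)
  : Set (c₁ ⊔ ℓ₁ ⊔ c₂ ⊔ ℓ₂) where
  private
    module A = RawRelationAlgebra 𝔄
    module B = RawRelationAlgebra 𝔄′
  open MorphismDefinitions A.Carrier B.Carrier B._≈_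
  field
    isRelHomomorphism : IsRelHomomorphism A._≈_ B._≈_ f
    +-homo            : Homomorphic₂ f A._+_ B._+_
    ⁻-homo            : Homomorphic₁ f A._⁻ B._⁻
    ⨾-homo            : Homomorphic₂ f A._⨾_ B._⨾_
    ˘-homo            : Homomorphic₁ f A._˘ B._˘
    1'-homo           : Homomorphic₀ f A.1' B.1'
    injective         : Injective A._≈_ B._≈_ f
    surjective        : Surjective A._≈_ B._≈_ f

record RawCylindricAlgebra₃ c ℓ : Set (suc (c ⊔ ℓ)) where
  infix  9 _⁻
  infixl 7 _·_
  infixl 6 _+_
  infix  4 _≈_
  field
    Carrier : Set c
    _≈_     : Rel Carrier ℓ
    _+_     : Op₂ Carrier
    _·_     : Op₂ Carrier
    _⁻      : Op₁ Carrier
    0#      : Carrier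
    1#      : Carrier
    c[_]    : Fin 3 → Op₁ Carrier
    d       : Fin 3 → Fin 3 → Carrier

module _ {c ℓ} (ℭ : RawCylindricAlgebra₃ c ℓ) where
  open RawCylindricAlgebra₃ ℭ

  Nr₂ : Pred Carrier ℓ
  Nr₂ x = c[ 2F ] x ≈ x

  ra-comp : Op₂ Carrier
  ra-comp x y = c[ 2F ] (c[ 1F ] (d 1F 2F · x) · c[ 0F ] (d 0F 2F · y))

  ra-conv : Op₁ Carrier
  ra-conv x = c[ 2F ] (d 2F 0F · c[ 0F ] (d 0F 1F · c[ 1F ] (d 1F 2F · x)))

  -- An arbitrary algebra of this similarity type need not satisfy these
  -- closure conditions, without which Ra ℭ is not an algebra.
  record Nr₂-Closed : Set (c ⊔ ℓ) where
    field
      +-closed    : ∀ {x y} → x ∈ Nr₂ → y ∈ Nr₂ → x + y ∈ Nr₂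
      ⁻-closed    : ∀ {x} → x ∈ Nr₂ → x ⁻ ∈ Nr₂
      comp-closed : ∀ {x y} → x ∈ Nr₂ → y ∈ Nr₂ → ra-comp x y ∈ Nr₂
      conv-closed : ∀ {x} → x ∈ Nr₂ → ra-conv x ∈ Nr₂
      d₀₁-closed  : d 0F 1F ∈ Nr₂

  Ra : Nr₂-Closed → RawRelationAlgebra (c ⊔ ℓ) ℓ
  Ra closed = record
    { Carrier = Σ Carrier Nr₂
    ; _≈_     = λ (x , _) (y , _) → x ≈ y
    ; _+_     = λ (x , p) (y , q) → x + y , +-closed p q
    ; _⁻      = λ (x , p) → x ⁻ , ⁻-closed p
    ; _⨾_     = λ (x , p) (y , q) → ra-comp x y , comp-closed p q
    ; _˘      = λ (x , p) → ra-conv x , conv-closed p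
    ; 1'      = d 0F 1F , d₀₁-closed
    }
    where open Nr₂-Closed closed

-- Subsets of a setoid: predicates that do not distinguish equal elements.
𝒫 : ∀ {ℓ} → Setoid ℓ ℓ → Set (suc ℓ)
𝒫 {ℓ} S = Σ (Pred Carrier ℓ) (_Respects _≈_)
  where open Setoid S

record Structure₃ ℓ : Set (suc ℓ) where
  field
    setoid : Setoid ℓ ℓ
  open Setoid setoid public
  field
    T      : Fin 3 → Rel Carrier ℓ
    E      : Fin 3 → Fin 3 → Pred Carrier ℓ
    T-resp : ∀ κ → T κ Respects₂ _≈_
    E-resp : ∀ κ μ → E κ μ Respects _≈_

Cm : ∀ {ℓ} → Structure₃ ℓ → RawCylindricAlgebra₃ (suc ℓ) ℓ
Cm 𝔅 = record
  { Carrier = 𝒫 setoid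
  ; _≈_     = λ (X , _) (Y , _) → X ≐ Y
  ; _+_     = λ (X , p) (Y , q) → (λ y → X y ⊎ Y y) , λ e → map (p e) (q e)
  ; _·_     = λ (X , p) (Y , q) → (λ y → X y × Y y) , λ e (u , v) → p e u , q e v
  ; _⁻      = λ (X , p) → (λ y → ¬ X y) , λ e ¬Xy Xz → ¬Xy (p (sym e) Xz)
  ; 0#      = (λ _ → ⊥) , λ _ z → z
  ; 1#      = (λ _ → ⊤) , λ _ z → z
  ; c[_]    = λ κ (X , _) → (λ y → ∃ λ x → X x × T κ y x)
                          , λ e (x , Xx , Tyx) → x , Xx , T-respˡ κ e Tyx
  ; d       = λ κ μ → E κ μ , E-resp κ μ
  }
  where
  open Structure₃ 𝔅
  T-respˡ : ∀ κ {x y z} → y ≈ z → T κ y x → T κ z x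
  T-respˡ κ with _ , respˡ ← T-resp κ = respˡ

module _ {ℓ} (𝔄 : WA ℓ ℓ) where
  open WA 𝔄
  open IsEquivalence isEquivalence

  -- at κ is s_κ; equality of triples (below) ignores the proof fields.
  record SuitableTriple : Set ℓ where
    field
      at         : Fin 3 → Carrier
      isAtom     : ∀ κ → IsAtom (at κ)
      consistent : at 1F ≤ at 2F ⨾ at 0F

  open SuitableTriple

  ≤-respˡ : ∀ {x y z} → x ≈ y → x ≤ z → y ≤ z
  ≤-respˡ x≈y x≤z = trans (+-cong (sym x≈y) refl) x≤z

  tripleSetoid : Setoid ℓ ℓ
  tripleSetoid = record
    { Carrier       = SuitableTriple
    ; _≈_           = λ s t → ∀ κ → at s κ ≈ at t κ
    ; isEquivalence = record
      { refl  = λ _ → refl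
      ; sym   = λ p κ → sym (p κ)
      ; trans = λ p q κ → trans (p κ) (q κ)
      }
    }

  belowIdentity : Fin 3 → Pred SuitableTriple ℓ
  belowIdentity μ s = at s μ ≤ 1'

  diagonal : Fin 3 → Fin 3 → Pred SuitableTriple ℓ
  diagonal 0F 1F = belowIdentity 2F
  diagonal 1F 0F = belowIdentity 2F
  diagonal 0F 2F = belowIdentity 1F
  diagonal 2F 0F = belowIdentity 1F
  diagonal 1F 2F = belowIdentity 0F
  diagonal 2F 1F = belowIdentity 0F
  diagonal 0F 0F = λ _ → ⊤
  diagonal 1F 1F = λ _ → ⊤
  diagonal 2F 2F = λ _ → ⊤

  diagonal-resp : ∀ κ μ → diagonal κ μ Respects Setoid._≈_ tripleSetoid
  diagonal-resp 0F 1F e = ≤-respˡ (e 2F)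
  diagonal-resp 1F 0F e = ≤-respˡ (e 2F)
  diagonal-resp 0F 2F e = ≤-respˡ (e 1F)
  diagonal-resp 2F 0F e = ≤-respˡ (e 1F)
  diagonal-resp 1F 2F e = ≤-respˡ (e 0F)
  diagonal-resp 2F 1F e = ≤-respˡ (e 0F)
  diagonal-resp 0F 0F e = _
  diagonal-resp 1F 1F e = _
  diagonal-resp 2F 2F e = _

  suitable : Structure₃ ℓ
  suitable = record
    { setoid = tripleSetoid
    ; T      = λ κ s t → at s κ ≈ at t κ
    ; E      = diagonal
    ; T-resp = λ κ → (λ e p → trans p (e κ)) , (λ e p → trans (sym (e κ)) p)
    ; E-resp = diagonal-resp
    }

  φ : Carrier → 𝒫 tripleSetoid
  φ x = (λ t → at t 2F ≤ x) , λ e → ≤-respˡ (e 2F)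

{-# OPTIONS --safe #-}
-- The argument is the atom calculus of relation algebras: for atoms,
-- a ≤ x ⨾ y, x ≤ a ⨾ y ˘ and y ≤ x ˘ ⨾ a are equivalent, and an atom below
-- x ⨾ y is already below b ⨾ c for some atoms b ≤ x and c ≤ y.  In a suitable
-- triple s, therefore, s₀ ≤ 1' forces s₁ ≈ s₂, s₂ ≤ 1' forces s₁ ≈ s₀, and
-- s₁ ≤ 1' forces s₀ ≈ s₂ ˘; chasing a triple through the cylindrifications
-- computes relative product and converse.  Every atom a occurs as some s₂,
-- because a ≤ a ⨾ 1', which gives injectivity; suprema of atoms give
-- surjectivity.
module Submission where

open import Defs
open import Axiom.ExcludedMiddle using (ExcludedMiddle)
open import Data.Empty using (⊥; ⊥-elim)
open import Data.Fin.Patterns using (0F; 1F; 2F)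
open import Data.Product.Base using (∃; Σ-syntax; _×_; _,_; proj₁; proj₂)
open import Data.Sum.Base using (_⊎_; inj₁; inj₂; [_,_]′)
open import Level using (_⊔_)
open import Function.Base using (id; _∘_)
open import Relation.Binary.Bundles using (Setoid; Poset)
open import Relation.Binary.Structures using (IsEquivalence)
import Relation.Binary.Reasoning.Setoid as SetoidReasoning
import Relation.Binary.Reasoning.PartialOrder as PosetReasoning
open import Relation.Nullary.Decidable.Core using (yes; no)
open import Relation.Nullary.Negation.Core using (¬_)
open import Relation.Unary using (Pred; _∈_)

module WAProperties {c ℓ} (𝔄 : WA c ℓ) where
  open WA 𝔄
  open IsEquivalence isEquivalence

  setoid : Setoid c ℓ
  setoid = record { isEquivalence = isEquivalence }

  private module ≈R = SetoidReasoning setoid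

  -- Boolean algebra from Huntington's axiom.

  +-congˡ : ∀ {x y z} → y ≈ z → x + y ≈ x + z
  +-congˡ = +-cong refl

  +-congʳ : ∀ {x y z} → y ≈ z → y + x ≈ z + x
  +-congʳ p = +-cong p refl

  +-interchange : ∀ w x y z → (w + x) + (y + z) ≈ (w + y) + (x + z)
  +-interchange w x y z = begin
    (w + x) + (y + z) ≈⟨ +-assoc w x (y + z) ⟨
    w + (x + (y + z)) ≈⟨ +-congˡ (+-assoc x y z) ⟩
    w + ((x + y) + z) ≈⟨ +-congˡ (+-congʳ (+-comm x y)) ⟩
    w + ((y + x) + z) ≈⟨ +-congˡ (+-assoc y x z) ⟨
    w + (y + (x + z)) ≈⟨ +-assoc w y (x + z) ⟩
    (w + y) + (x + z) ∎
    where open ≈R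

  -- Expanding x, x ⁻, y, y ⁻ by Huntington's axiom turns both sides into the
  -- same sum of four terms.
  +-complement-unique : ∀ x y → x + x ⁻ ≈ y + y ⁻
  +-complement-unique x y = begin
    x + x ⁻
      ≈⟨ +-cong (huntington x (y ⁻)) (huntington (x ⁻) (y ⁻)) ⟨
    ((x ⁻ + y ⁻ ⁻) ⁻ + (x ⁻ + y ⁻) ⁻) + ((x ⁻ ⁻ + y ⁻ ⁻) ⁻ + (x ⁻ ⁻ + y ⁻) ⁻)
      ≈⟨ +-cong (+-comm _ _) (+-comm _ _) ⟩
    ((x ⁻ + y ⁻) ⁻ + (x ⁻ + y ⁻ ⁻) ⁻) + ((x ⁻ ⁻ + y ⁻) ⁻ + (x ⁻ ⁻ + y ⁻ ⁻) ⁻)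
      ≈⟨ +-interchange _ _ _ _ ⟩
    ((x ⁻ + y ⁻) ⁻ + (x ⁻ ⁻ + y ⁻) ⁻) + ((x ⁻ + y ⁻ ⁻) ⁻ + (x ⁻ ⁻ + y ⁻ ⁻) ⁻)
      ≈⟨ +-cong (+-cong (flip _ _) (flip _ _)) (+-cong (flip _ _) (flip _ _)) ⟩
    ((y ⁻ + x ⁻) ⁻ + (y ⁻ + x ⁻ ⁻) ⁻) + ((y ⁻ ⁻ + x ⁻) ⁻ + (y ⁻ ⁻ + x ⁻ ⁻) ⁻)
      ≈⟨ +-cong (+-comm _ _) (+-comm _ _) ⟩
    ((y ⁻ + x ⁻ ⁻) ⁻ + (y ⁻ + x ⁻) ⁻) + ((y ⁻ ⁻ + x ⁻ ⁻) ⁻ + (y ⁻ ⁻ + x ⁻) ⁻)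
      ≈⟨ +-cong (huntington y (x ⁻)) (huntington (y ⁻) (x ⁻)) ⟩
    y + y ⁻ ∎
    where
    open ≈R
    flip : ∀ u v → (u + v) ⁻ ≈ (v + u) ⁻
    flip u v = ⁻-cong (+-comm u v)

  +-complementʳ : ∀ x → x + x ⁻ ≈ 1#
  +-complementʳ x = +-complement-unique x 1'

  +-complementˡ : ∀ x → x ⁻ + x ≈ 1#
  +-complementˡ x = trans (+-comm _ _) (+-complementʳ x)

  -- The Huntington expansions of `x ⁻ ⁻` by `x ⁻` and of `x` by `x ⁻ ⁻` have the same two terms,
  -- once `x ⁻ ⁻ ⁻ + x ⁻ ⁻` is exchanged for `x ⁻ + x ⁻ ⁻`, both being `1#`.
  ⁻-involutive : ∀ x → x ⁻ ⁻ ≈ x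
  ⁻-involutive x = begin
    x ⁻ ⁻                                     ≈⟨ huntington (x ⁻ ⁻) (x ⁻) ⟨
    (x ⁻ ⁻ ⁻ + x ⁻ ⁻) ⁻ + (x ⁻ ⁻ ⁻ + x ⁻) ⁻
      ≈⟨ +-cong (⁻-cong (trans (+-complementˡ _) (sym (+-complementʳ _))))
                (⁻-cong (+-comm _ _)) ⟩
    (x ⁻ + x ⁻ ⁻) ⁻ + (x ⁻ + x ⁻ ⁻ ⁻) ⁻       ≈⟨ +-comm _ _ ⟩
    (x ⁻ + x ⁻ ⁻ ⁻) ⁻ + (x ⁻ + x ⁻ ⁻) ⁻       ≈⟨ huntington x (x ⁻ ⁻) ⟩
    x                                         ∎
    where open ≈R

  -- Expanding `0#` against itself yields the summand `(1# + 1#) ⁻`, which `1# ≈ 1# + 0#` therefore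
  -- absorbs; one more `1#` completes it to a sum of complements.
  1#+1#≈1# : 1# + 1# ≈ 1#
  1#+1#≈1# = begin
    1# + 1#                     ≈⟨ +-congˡ 1#≈1#+[1#+1#]⁻ ⟩
    1# + (1# + (1# + 1#) ⁻)     ≈⟨ +-assoc _ _ _ ⟩
    (1# + 1#) + (1# + 1#) ⁻     ≈⟨ +-complementʳ _ ⟩
    1#                          ∎
    where
    open ≈R
    0#≈[1#+1#]⁻+0# : 0# ≈ (1# + 1#) ⁻ + 0#
    0#≈[1#+1#]⁻+0# = begin
      0#                                ≈⟨ huntington 0# 0# ⟨
      (0# ⁻ + 0# ⁻) ⁻ + (0# ⁻ + 0#) ⁻
        ≈⟨ +-cong (⁻-cong (+-cong (⁻-involutive 1#) (⁻-involutive 1#)))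
                  (⁻-cong (+-complementˡ 0#)) ⟩
      (1# + 1#) ⁻ + 0#                  ∎
    1#≈1#+[1#+1#]⁻ : 1# ≈ 1# + (1# + 1#) ⁻
    1#≈1#+[1#+1#]⁻ = begin
      1#                        ≈⟨ +-complementʳ 1# ⟨
      1# + 0#                   ≈⟨ +-congˡ (trans 0#≈[1#+1#]⁻+0# (+-comm _ _)) ⟩
      1# + (0# + (1# + 1#) ⁻)   ≈⟨ +-assoc _ _ _ ⟩
      (1# + 0#) + (1# + 1#) ⁻   ≈⟨ +-congʳ (+-complementʳ 1#) ⟩
      1# + (1# + 1#) ⁻          ∎

  -- Exhibits every element as a sum ending in `0#`, so that neutrality of `0#` reduces to
  -- `0# + 0# ≈ 0#`.
  huntington-diagonal : ∀ x → (x ⁻ + x ⁻) ⁻ + 0# ≈ x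
  huntington-diagonal x =
    trans (+-congˡ (⁻-cong (sym (+-complementˡ x)))) (huntington x x)

  0#+0#≈0# : 0# + 0# ≈ 0#
  0#+0#≈0# = trans (+-congʳ (⁻-cong 1#≈0#⁻+0#⁻)) (huntington-diagonal 0#)
    where
    1#≈0#⁻+0#⁻ : 1# ≈ 0# ⁻ + 0# ⁻
    1#≈0#⁻+0#⁻ = trans (sym 1#+1#≈1#)
      (+-cong (sym (⁻-involutive 1#)) (sym (⁻-involutive 1#)))

  +-identityʳ : ∀ x → x + 0# ≈ x
  +-identityʳ x = begin
    x + 0#                          ≈⟨ +-congʳ (huntington-diagonal x) ⟨
    ((x ⁻ + x ⁻) ⁻ + 0#) + 0#       ≈⟨ +-assoc _ _ _ ⟨
    (x ⁻ + x ⁻) ⁻ + (0# + 0#)       ≈⟨ +-congˡ 0#+0#≈0# ⟩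
    (x ⁻ + x ⁻) ⁻ + 0#              ≈⟨ huntington-diagonal x ⟩
    x                               ∎
    where open ≈R

  +-idem : ∀ x → x + x ≈ x
  +-idem x = begin
    x + x                     ≈⟨ +-cong (⁻-involutive x) (⁻-involutive x) ⟨
    x ⁻ ⁻ + x ⁻ ⁻             ≈⟨ ⁻-involutive _ ⟨
    (x ⁻ ⁻ + x ⁻ ⁻) ⁻ ⁻
      -- The diagonal instance at `x ⁻`, with its `0#` dropped, reads `(x ⁻ ⁻ + x ⁻ ⁻) ⁻ ≈ x ⁻`.
      ≈⟨ ⁻-cong (trans (sym (+-identityʳ _)) (huntington-diagonal (x ⁻))) ⟩
    x ⁻ ⁻                     ≈⟨ ⁻-involutive x ⟩
    x                         ∎
    where open ≈R

  +-zeroʳ : ∀ x → x + 1# ≈ 1#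
  +-zeroʳ x = begin
    x + 1#          ≈⟨ +-congˡ (+-complementʳ x) ⟨
    x + (x + x ⁻)   ≈⟨ +-assoc _ _ _ ⟩
    (x + x) + x ⁻   ≈⟨ +-congʳ (+-idem x) ⟩
    x + x ⁻         ≈⟨ +-complementʳ x ⟩
    1#              ∎
    where open ≈R

  -- The Boolean order, meets and complements.

  ≤-trans : ∀ {x y z} → x ≤ y → y ≤ z → x ≤ z
  ≤-trans {x} {y} {z} x≤y y≤z = begin
    x + z         ≈⟨ +-congˡ y≤z ⟨
    x + (y + z)   ≈⟨ +-assoc _ _ _ ⟩
    (x + y) + z   ≈⟨ +-congʳ x≤y ⟩
    y + z         ≈⟨ y≤z ⟩
    z             ∎
    where open ≈R

  ≤-reflexive : ∀ {x y} → x ≈ y → x ≤ y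
  ≤-reflexive {x} {y} x≈y = trans (+-congʳ x≈y) (+-idem y)

  ≤-antisym : ∀ {x y} → x ≤ y → y ≤ x → x ≈ y
  ≤-antisym x≤y y≤x = trans (sym y≤x) (trans (+-comm _ _) x≤y)

  poset : Poset c ℓ ℓ
  poset = record
    { isPartialOrder = record
      { isPreorder = record
        { isEquivalence = isEquivalence
        ; reflexive     = ≤-reflexive
        ; trans         = ≤-trans
        }
      ; antisym = ≤-antisym
      }
    }

  private module ≤R = PosetReasoning poset

  x≤x+y : ∀ {x y} → x ≤ x + y
  x≤x+y {x} {y} = trans (+-assoc x x y) (+-congʳ (+-idem x))

  y≤x+y : ∀ {x y} → y ≤ x + y
  y≤x+y = ≤-trans x≤x+y (≤-reflexive (+-comm _ _))

  0#-minimum : ∀ x → 0# ≤ x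
  0#-minimum x = trans (+-comm 0# x) (+-identityʳ x)

  ≤0#⇒≈0# : ∀ {x} → x ≤ 0# → x ≈ 0#
  ≤0#⇒≈0# x≤0 = ≤-antisym x≤0 (0#-minimum _)

  1#-maximum : ∀ x → x ≤ 1#
  1#-maximum = +-zeroʳ

  ≤⇒⁻+≈1# : ∀ {x y} → x ≤ y → x ⁻ + y ≈ 1#
  ≤⇒⁻+≈1# {x} {y} x≤y = begin
    x ⁻ + y         ≈⟨ +-congˡ x≤y ⟨
    x ⁻ + (x + y)   ≈⟨ +-assoc _ _ _ ⟩
    (x ⁻ + x) + y   ≈⟨ +-congʳ (+-complementˡ x) ⟩
    1# + y          ≈⟨ +-comm _ _ ⟩
    y + 1#          ≈⟨ +-zeroʳ y ⟩
    1#              ∎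
    where open ≈R

  -- The hypothesis kills the second Huntington term of `x`; what remains is `x · y`, which is also
  -- a Huntington term of `y`.
  ⁻+≈1#⇒≤ : ∀ {x y} → x ⁻ + y ≈ 1# → x ≤ y
  ⁻+≈1#⇒≤ {x} {y} x⁻+y≈1 = begin
    x                               ≈⟨ huntington x y ⟨
    (x ⁻ + y ⁻) ⁻ + (x ⁻ + y) ⁻     ≈⟨ +-congˡ (⁻-cong x⁻+y≈1) ⟩
    (x ⁻ + y ⁻) ⁻ + 0#              ≈⟨ +-identityʳ _ ⟩
    (x ⁻ + y ⁻) ⁻                   ≈⟨ ⁻-cong (+-comm _ _) ⟩
    (y ⁻ + x ⁻) ⁻                   ≤⟨ x≤x+y ⟩
    (y ⁻ + x ⁻) ⁻ + (y ⁻ + x) ⁻     ≈⟨ huntington y x ⟩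
    y                               ∎
    where open ≤R

  -- Both inequalities amount to `x ⁻ + y ⁻ ≈ 1#`, which is symmetric.
  ⁻-swap : ∀ {x y} → x ≤ y ⁻ → y ≤ x ⁻
  ⁻-swap x≤y⁻ = ⁻+≈1#⇒≤ (trans (+-comm _ _) (≤⇒⁻+≈1# x≤y⁻))

  ⁻-anti : ∀ {x y} → x ≤ y → y ⁻ ≤ x ⁻
  ⁻-anti x≤y = ⁻-swap (≤-trans x≤y (≤-reflexive (sym (⁻-involutive _))))

  x·y≤x : ∀ {x y} → x · y ≤ x
  x·y≤x = ≤-trans (⁻-anti x≤x+y) (≤-reflexive (⁻-involutive _))

  x·y≤y : ∀ {x y} → x · y ≤ y
  x·y≤y = ≤-trans (⁻-anti y≤x+y) (≤-reflexive (⁻-involutive _))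

  +-least : ∀ {x y z} → x ≤ z → y ≤ z → x + y ≤ z
  +-least {x} {y} {z} x≤z y≤z =
    trans (sym (+-assoc x y z)) (trans (+-congˡ y≤z) x≤z)

  ·-greatest : ∀ {x y z} → z ≤ x → z ≤ y → z ≤ x · y
  ·-greatest z≤x z≤y = ⁻-swap (+-least (⁻-anti z≤x) (⁻-anti z≤y))

  ·≈0#⇒≤⁻ : ∀ {x y} → x · y ≈ 0# → x ≤ y ⁻
  ·≈0#⇒≤⁻ {x} {y} x·y≈0 = ⁻+≈1#⇒≤
    (trans (sym (⁻-involutive _)) (trans (⁻-cong x·y≈0) (⁻-involutive _)))

  ≤∧≤⁻⇒≈0# : ∀ {x y} → x ≤ y → x ≤ y ⁻ → x ≈ 0#
  ≤∧≤⁻⇒≈0# {x} {y} x≤y x≤y⁻ = ≤0#⇒≈0#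
    (≤-trans (·-greatest x≤y x≤y⁻) (≤-reflexive (⁻-cong (+-complementʳ (y ⁻)))))

  -- Converse and the identity element.

  ˘-mono : ∀ {x y} → x ≤ y → x ˘ ≤ y ˘
  ˘-mono x≤y = trans (sym (˘-+ _ _)) (˘-cong x≤y)

  ˘-cancel-≤ : ∀ {x y} → x ˘ ≤ y ˘ → x ≤ y
  ˘-cancel-≤ {x} {y} p = begin
    x       ≈⟨ ˘-involutive x ⟨
    x ˘ ˘   ≤⟨ ˘-mono p ⟩
    y ˘ ˘   ≈⟨ ˘-involutive y ⟩
    y       ∎
    where open ≤R

  ˘-adjoint : ∀ {x y} → x ˘ ≤ y → x ≤ y ˘
  ˘-adjoint p = ˘-cancel-≤ (≤-trans p (≤-reflexive (sym (˘-involutive _))))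

  1#˘≈1# : 1# ˘ ≈ 1#
  1#˘≈1# = ≤-antisym (1#-maximum _) (˘-adjoint (1#-maximum _))

  0#˘≈0# : 0# ˘ ≈ 0#
  0#˘≈0# = ≤0#⇒≈0# (˘-cancel-≤ (≤-trans (≤-reflexive (˘-involutive _)) (0#-minimum _)))

  ˘⁻≤⁻˘ : ∀ x → x ˘ ⁻ ≤ x ⁻ ˘
  ˘⁻≤⁻˘ x = ⁻+≈1#⇒≤ (begin
    x ˘ ⁻ ⁻ + x ⁻ ˘   ≈⟨ +-congʳ (⁻-involutive _) ⟩
    x ˘ + x ⁻ ˘       ≈⟨ ˘-+ x (x ⁻) ⟨
    (x + x ⁻) ˘       ≈⟨ ˘-cong (+-complementʳ x) ⟩
    1# ˘              ≈⟨ 1#˘≈1# ⟩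
    1#                ∎)
    where open ≈R

  -- The opposite inclusion, taken at `x ˘` and read under a further converse.
  ⁻˘≤˘⁻ : ∀ x → x ⁻ ˘ ≤ x ˘ ⁻
  ⁻˘≤˘⁻ x = ˘-cancel-≤ (begin
    x ⁻ ˘ ˘     ≈⟨ ˘-involutive _ ⟩
    x ⁻         ≈⟨ ⁻-cong (˘-involutive x) ⟨
    x ˘ ˘ ⁻     ≤⟨ ˘⁻≤⁻˘ (x ˘) ⟩
    x ˘ ⁻ ˘     ∎)
    where open ≤R

  -- The product `1' ˘ ⨾ 1'` is its own converse, and the right identity law reduces it to `1' ˘`.
  1'˘≈1' : 1' ˘ ≈ 1'
  1'˘≈1' = begin
    1' ˘              ≈⟨ ⨾-identityʳ _ ⟨
    1' ˘ ⨾ 1'         ≈⟨ ⨾-cong refl (˘-involutive 1') ⟨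
    1' ˘ ⨾ 1' ˘ ˘     ≈⟨ ˘-⨾ (1' ˘) 1' ⟨
    (1' ˘ ⨾ 1') ˘     ≈⟨ ˘-cong (⨾-identityʳ _) ⟩
    1' ˘ ˘            ≈⟨ ˘-involutive 1' ⟩
    1'                ∎
    where open ≈R

  ⨾-identityˡ : ∀ x → 1' ⨾ x ≈ x
  ⨾-identityˡ x = begin
    1' ⨾ x              ≈⟨ ⨾-cong 1'˘≈1' (˘-involutive x) ⟨
    1' ˘ ⨾ x ˘ ˘        ≈⟨ ˘-⨾ (x ˘) 1' ⟨
    (x ˘ ⨾ 1') ˘        ≈⟨ ˘-cong (⨾-identityʳ _) ⟩
    x ˘ ˘               ≈⟨ ˘-involutive x ⟩
    x                   ∎
    where open ≈R

  -- Monotonicity of relative product and the Peirce laws.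

  ⨾-monoˡ : ∀ {x y z} → x ≤ y → x ⨾ z ≤ y ⨾ z
  ⨾-monoˡ x≤y = trans (sym (⨾-distribʳ-+ _ _ _)) (⨾-cong x≤y refl)

  ⨾-monoʳ : ∀ {x y z} → x ≤ y → z ⨾ x ≤ z ⨾ y
  ⨾-monoʳ {x} {y} {z} x≤y = ˘-cancel-≤ (begin
    (z ⨾ x) ˘   ≈⟨ ˘-⨾ z x ⟩
    x ˘ ⨾ z ˘   ≤⟨ ⨾-monoˡ (˘-mono x≤y) ⟩
    y ˘ ⨾ z ˘   ≈⟨ ˘-⨾ z y ⟨
    (z ⨾ y) ˘   ∎)
    where open ≤R

  ⨾-mono : ∀ {w x y z} → w ≤ x → y ≤ z → w ⨾ y ≤ x ⨾ z
  ⨾-mono w≤x y≤z = ≤-trans (⨾-monoˡ w≤x) (⨾-monoʳ y≤z)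

  -- Since `z` lies below `(x ⨾ y) ⁻`, Tarski's axiom bounds `x ˘ ⨾ z`.
  peirceˡ : ∀ {x y z} → x ⨾ y ≤ z ⁻ → x ˘ ⨾ z ≤ y ⁻
  peirceˡ p = ≤-trans (⨾-monoʳ (⁻-swap p)) (tarski _ _)

  -- The mirror image of `peirceˡ`: converse reverses products and commutes with complement.
  peirceʳ : ∀ {x y z} → x ⨾ y ≤ z ⁻ → z ⨾ y ˘ ≤ x ⁻
  peirceʳ {x} {y} {z} p = ˘-cancel-≤ (begin
    (z ⨾ y ˘) ˘   ≈⟨ ˘-⨾ z (y ˘) ⟩
    y ˘ ˘ ⨾ z ˘   ≤⟨ peirceˡ y˘⨾x˘≤z˘⁻ ⟩
    x ˘ ⁻         ≤⟨ ˘⁻≤⁻˘ x ⟩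
    x ⁻ ˘         ∎)
    where
    open ≤R
    y˘⨾x˘≤z˘⁻ : y ˘ ⨾ x ˘ ≤ z ˘ ⁻
    y˘⨾x˘≤z˘⁻ = begin
      y ˘ ⨾ x ˘   ≈⟨ ˘-⨾ x y ⟨
      (x ⨾ y) ˘   ≤⟨ ˘-mono p ⟩
      z ⁻ ˘       ≤⟨ ⁻˘≤˘⁻ z ⟩
      z ˘ ⁻       ∎

  -- Atoms and the cycle laws.

  atom-⁻-cases : ∀ {a} → IsAtom a → ∀ x → a ≤ x ⊎ a ≤ x ⁻
  atom-⁻-cases {a} (_ , min) x =
    -- Atomhood itself decides whether `a · x` is `0#` or `a`, so no excluded middle enters.
    [ inj₂ ∘ ·≈0#⇒≤⁻
    , (λ a·x≈a → inj₁ (≤-trans (≤-reflexive (sym a·x≈a)) x·y≤y))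
    ]′ (min (a · x) x·y≤x)

  atom-≤⇒≰⁻ : ∀ {a x} → IsAtom a → a ≤ x → ¬ (a ≤ x ⁻)
  atom-≤⇒≰⁻ (a≉0 , _) a≤x a≤x⁻ = a≉0 (≤∧≤⁻⇒≈0# a≤x a≤x⁻)

  atom-≤-⁻ : ∀ {a x} → IsAtom a → ¬ (a ≤ x) → a ≤ x ⁻
  atom-≤-⁻ at a≰x = [ ⊥-elim ∘ a≰x , id ]′ (atom-⁻-cases at _)

  atom-≤-+ : ∀ {a x y} → IsAtom a → a ≤ x + y → a ≤ x ⊎ a ≤ y
  atom-≤-+ {a} {x} {y} at a≤x+y =
    [ inj₁ , (λ a≤x⁻ → [ inj₂ , (λ a≤y⁻ → ⊥-elim (absurd a≤x⁻ a≤y⁻)) ]′ (atom-⁻-cases at y)) ]′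
      (atom-⁻-cases at x)
    where
    absurd : a ≤ x ⁻ → a ≤ y ⁻ → ⊥
    absurd a≤x⁻ a≤y⁻ =
      atom-≤⇒≰⁻ at a≤x+y (⁻-swap (+-least (⁻-swap a≤x⁻) (⁻-swap a≤y⁻)))

  atom-≤⇒≈ : ∀ {a b} → IsAtom a → IsAtom b → a ≤ b → a ≈ b
  atom-≤⇒≈ (a≉0 , _) (_ , min) a≤b = [ ⊥-elim ∘ a≉0 , id ]′ (min _ a≤b)

  -- Converse is an order-preserving involution fixing `0#`, hence permutes the atoms.
  ˘-atom : ∀ {a} → IsAtom a → IsAtom (a ˘)
  ˘-atom {a} (a≉0 , min) =
      (λ a˘≈0 → a≉0 (trans (sym (˘-involutive a)) (trans (˘-cong a˘≈0) 0#˘≈0#)))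
    , λ x x≤a˘ → [ (λ x˘≈0 → inj₁ (trans (unconverse x˘≈0) 0#˘≈0#))
                 , (λ x˘≈a → inj₂ (unconverse x˘≈a))
                 ]′ (min (x ˘) (≤-trans (˘-mono x≤a˘) (≤-reflexive (˘-involutive a))))
    where
    unconverse : ∀ {x y} → x ˘ ≈ y → x ≈ y ˘
    unconverse p = trans (sym (˘-involutive _)) (˘-cong p)

  -- Otherwise the atom `x` lies below `(a ⨾ y ˘) ⁻`, and Peirce's law puts `x ⨾ y`, hence `a`,
  -- below `a ⁻`. The factor `y` may be any element, which factorization relies on.
  cycleˡ : ∀ {a x y} → IsAtom a → IsAtom x → a ≤ x ⨾ y → x ≤ a ⨾ y ˘
  cycleˡ {a} {x} {y} a-at x-at a≤x⨾y =
    [ id , (λ x≤ → ⊥-elim (atom-≤⇒≰⁻ a-at a≤x⨾y (⁻-swap (x⨾y≤a⁻ x≤)))) ]′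
      (atom-⁻-cases x-at (a ⨾ y ˘))
    where
    x⨾y≤a⁻ : x ≤ (a ⨾ y ˘) ⁻ → x ⨾ y ≤ a ⁻
    x⨾y≤a⁻ p = ≤-trans (≤-reflexive (⨾-cong refl (sym (˘-involutive y))))
                       (peirceʳ (⁻-swap p))

  cycleʳ : ∀ {a x y} → IsAtom a → IsAtom y → a ≤ x ⨾ y → y ≤ x ˘ ⨾ a
  cycleʳ {a} {x} {y} a-at y-at a≤x⨾y =
    [ id , (λ y≤ → ⊥-elim (atom-≤⇒≰⁻ a-at a≤x⨾y (⁻-swap (x⨾y≤a⁻ y≤)))) ]′
      (atom-⁻-cases y-at (x ˘ ⨾ a))
    where
    x⨾y≤a⁻ : y ≤ (x ˘ ⨾ a) ⁻ → x ⨾ y ≤ a ⁻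
    x⨾y≤a⁻ p = ≤-trans (≤-reflexive (⨾-cong (sym (˘-involutive x)) refl))
                       (peirceˡ (⁻-swap p))

  -- Consequences of atomicity.

  module Atomic (em : ExcludedMiddle ℓ) (atomic : IsAtomic) where

    meeting-atom : ∀ {x y} → ¬ (x ≤ y ⁻) → ∃ λ a → IsAtom a × a ≤ x × a ≤ y
    meeting-atom {x} {y} x≰y⁻ =
      let a , at , a≤x·y = atomic (x · y) (x≰y⁻ ∘ ·≈0#⇒≤⁻)
      in  a , at , ≤-trans a≤x·y x·y≤x , ≤-trans a≤x·y x·y≤y

    ≤-by-atoms : ∀ {x y} → (∀ {a} → IsAtom a → a ≤ x → a ≤ y) → x ≤ y
    ≤-by-atoms {x} {y} below with em {x ≤ y}
    ... | yes x≤y = x≤y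
    ... | no  x≰y =
      let a , at , a≤x , a≤y⁻ = meeting-atom {x} {y ⁻}
             (λ p → x≰y (≤-trans p (≤-reflexive (⁻-involutive y))))
      in  ⊥-elim (atom-≤⇒≰⁻ at (below at a≤x) a≤y⁻)

    -- If `x` were disjoint from `a ⨾ y ˘`, Peirce's law would put `x ⨾ y` below `a ⁻`. So some atom
    -- lies under both, and the cycle law returns `a` to the left-hand side.
    factorˡ : ∀ {a x y} → IsAtom a → a ≤ x ⨾ y → ∃ λ b → IsAtom b × b ≤ x × a ≤ b ⨾ y
    factorˡ {a} {x} {y} a-at a≤x⨾y =
      let b , b-at , b≤x , b≤a⨾y˘ = meeting-atom {x} {a ⨾ y ˘}
             (λ p → atom-≤⇒≰⁻ a-at a≤x⨾y (⁻-swap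
               (≤-trans (≤-reflexive (⨾-cong refl (sym (˘-involutive y))))
                        (peirceʳ (⁻-swap p)))))
      in  b , b-at , b≤x , ≤-trans (cycleˡ b-at a-at b≤a⨾y˘)
                                   (≤-reflexive (⨾-cong refl (˘-involutive y)))

    factorʳ : ∀ {a x y} → IsAtom a → a ≤ x ⨾ y → ∃ λ b → IsAtom b × b ≤ y × a ≤ x ⨾ b
    factorʳ {a} {x} {y} a-at a≤x⨾y =
      let b , b-at , b≤y , b≤x˘⨾a = meeting-atom {y} {x ˘ ⨾ a}
             (λ p → atom-≤⇒≰⁻ a-at a≤x⨾y (⁻-swap
               (≤-trans (≤-reflexive (⨾-cong (sym (˘-involutive x)) refl))
                        (peirceˡ (⁻-swap p)))))
      in  b , b-at , b≤y , ≤-trans (cycleʳ b-at a-at b≤x˘⨾a)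
                                   (≤-reflexive (⨾-cong (˘-involutive x) refl))

    -- If `a` were below no member of `S`, every member would lie below `a ⁻`, making `a ⁻` an upper
    -- bound and forcing `a ≤ a ⁻`.
    atom-≤-lub : ∀ {p a u} {S : Pred Carrier p} → ExcludedMiddle (c ⊔ ℓ ⊔ p) →
                 IsAtom a → IsLUB S u → a ≤ u → ∃ λ x → x ∈ S × a ≤ x
    atom-≤-lub {a = a} {S = S} em′ a-at (_ , least) a≤u
      with em′ {∃ λ x → x ∈ S × a ≤ x}
    ... | yes found = found
    ... | no  none  = ⊥-elim (atom-≤⇒≰⁻ a-at a≤u (⁻-swap (least (a ⁻)
            λ x x∈S → ⁻-swap (atom-≤-⁻ a-at λ a≤x → none (x , x∈S , a≤x)))))

-- Suitable triples and the two-dimensional elements.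

module _ {ℓ} (𝔄 : WA ℓ ℓ) where
  open WA 𝔄
  open IsEquivalence isEquivalence
  open WAProperties 𝔄
  open SuitableTriple

  private
    Cm𝔅 = Cm (suitable 𝔄)
    Triple = SuitableTriple 𝔄

  triple : ∀ {a b c} → IsAtom a → IsAtom b → IsAtom c → b ≤ c ⨾ a → Triple
  triple {a} {b} {c} a-at b-at c-at b≤c⨾a = record
    { at         = λ { 0F → a ; 1F → b ; 2F → c }
    ; isAtom     = λ { 0F → a-at ; 1F → b-at ; 2F → c-at }
    ; consistent = b≤c⨾a
    }

  belowIdentity₀⇒at₁≈at₂ : (s : Triple) → at s 0F ≤ 1' → at s 1F ≈ at s 2F
  belowIdentity₀⇒at₁≈at₂ s s₀≤1' = atom-≤⇒≈ (isAtom s 1F) (isAtom s 2F)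
    (≤-trans (consistent s) (≤-trans (⨾-monoʳ s₀≤1') (≤-reflexive (⨾-identityʳ _))))

  belowIdentity₂⇒at₁≈at₀ : (s : Triple) → at s 2F ≤ 1' → at s 1F ≈ at s 0F
  belowIdentity₂⇒at₁≈at₀ s s₂≤1' = atom-≤⇒≈ (isAtom s 1F) (isAtom s 0F)
    (≤-trans (consistent s) (≤-trans (⨾-monoˡ s₂≤1') (≤-reflexive (⨾-identityˡ _))))

  -- The cycle law turns consistency into `s₀ ≤ s₂ ˘ ⨾ s₁`, where `s₁` is absorbed by the identity.
  belowIdentity₁⇒at₀≈at₂˘ : (s : Triple) → at s 1F ≤ 1' → at s 0F ≈ at s 2F ˘
  belowIdentity₁⇒at₀≈at₂˘ s s₁≤1' = atom-≤⇒≈ (isAtom s 0F) (˘-atom (isAtom s 2F))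
    (≤-trans (cycleʳ (isAtom s 1F) (isAtom s 0F) (consistent s))
      (≤-trans (⨾-monoʳ s₁≤1') (≤-reflexive (⨾-identityʳ _))))

  -- `T 2F` is an equivalence, so the fixed points of `c[ 2F ]` are the unions of its classes: a
  -- Boolean family containing every value of `c[ 2F ]`.
  Nr₂-closed : Nr₂-Closed Cm𝔅
  Nr₂-closed = record
    { +-closed    = λ { {X , _} {Y , _} (cX⊆X , _) (cY⊆Y , _) →
        (λ { (s , inj₁ s∈X , e) → inj₁ (cX⊆X (s , s∈X , e))
           ; (s , inj₂ s∈Y , e) → inj₂ (cY⊆Y (s , s∈Y , e)) })
      , λ {t} t∈X∪Y → t , t∈X∪Y , refl }
    ; ⁻-closed    = λ { {X , _} (cX⊆X , _) →
        (λ { {t} (s , s∉X , e) t∈X → s∉X (cX⊆X (t , t∈X , sym e)) })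
      , λ {t} t∉X → t , t∉X , refl }
    ; comp-closed = λ {X} {Y} _ _ → c₂-idem
        (c[ 1F ] (d 1F 2F ⊓ X) ⊓ c[ 0F ] (d 0F 2F ⊓ Y))
    ; conv-closed = λ {X} _ → c₂-idem
        (d 2F 0F ⊓ c[ 0F ] (d 0F 1F ⊓ c[ 1F ] (d 1F 2F ⊓ X)))
    ; d₀₁-closed  = (λ { (s , s₂≤1' , e) → ≤-respˡ 𝔄 (sym e) s₂≤1' })
                  , λ {t} t₂≤1' → t , t₂≤1' , refl
    }
    where
    open RawCylindricAlgebra₃ Cm𝔅 using (c[_]; d) renaming (_·_ to _⊓_)
    c₂-idem : ∀ X → c[ 2F ] X ∈ Nr₂ Cm𝔅
    c₂-idem _ = (λ { (s , (r , r∈X , e′) , e) → r , r∈X , trans e e′ })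
              , λ {t} t∈cX → t , t∈cX , refl

  -- The map on Boolean operations.

  φ∈Nr₂ : ∀ x → φ 𝔄 x ∈ Nr₂ Cm𝔅
  φ∈Nr₂ x = (λ { (s , s₂≤x , e) → ≤-respˡ 𝔄 (sym e) s₂≤x })
          , λ {t} t₂≤x → t , t₂≤x , refl

  open RawRelationAlgebra (Ra Cm𝔅 Nr₂-closed) using ()
    renaming (Carrier to RaCarrier; _≈_ to _≋_; _+_ to _∪_; _⁻ to ∁; _⨾_ to _⨟_; _˘ to _˘ʳ)

  φʳ : Carrier → RaCarrier
  φʳ x = φ 𝔄 x , φ∈Nr₂ x

  φ-mono : ∀ {x y} → x ≈ y → ∀ {t} → proj₁ (φ 𝔄 x) t → proj₁ (φ 𝔄 y) t
  φ-mono x≈y t₂≤x = ≤-trans t₂≤x (≤-reflexive x≈y)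

  φ-+ : ∀ x y → φʳ (x + y) ≋ φʳ x ∪ φʳ y
  φ-+ x y = (λ {t} → atom-≤-+ (isAtom t 2F))
          , [ (λ p → ≤-trans p x≤x+y) , (λ p → ≤-trans p y≤x+y) ]′

  φ-⁻ : ∀ x → φʳ (x ⁻) ≋ ∁ (φʳ x)
  φ-⁻ x = (λ {t} t₂≤x⁻ t₂≤x → atom-≤⇒≰⁻ (isAtom t 2F) t₂≤x t₂≤x⁻)
        , λ {t} → atom-≤-⁻ (isAtom t 2F)

  -- The map on relative product and converse.

  module _ (em : ExcludedMiddle ℓ) (atomic : IsAtomic) where
    open Atomic em atomic

    -- Factoring `a ≤ a ⨾ 1'` supplies the atom below `1'`. Such triples are the witnesses that
    -- carry an atom from one index to another through a cylindrified diagonal.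
    diagonal₁₂-triple : ∀ {a} → IsAtom a →
      Σ[ s ∈ Triple ] at s 0F ≤ 1' × at s 1F ≈ a × at s 2F ≈ a
    diagonal₁₂-triple {a} a-at =
      let e , e-at , e≤1' , a≤a⨾e = factorʳ a-at (≤-reflexive (sym (⨾-identityʳ a)))
      in  triple e-at a-at a-at a≤a⨾e , e≤1' , refl , refl

    diagonal₀₁-triple : ∀ {a} → IsAtom a →
      Σ[ s ∈ Triple ] at s 2F ≤ 1' × at s 0F ≈ a × at s 1F ≈ a
    diagonal₀₁-triple {a} a-at =
      let e , e-at , e≤1' , a≤e⨾a = factorˡ a-at (≤-reflexive (sym (⨾-identityˡ a)))
      in  triple a-at a-at e-at a≤e⨾a , e≤1' , refl , refl

    diagonal₀₂-triple : ∀ {a} → IsAtom a →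
      Σ[ s ∈ Triple ] at s 1F ≤ 1' × at s 0F ≈ a ˘ × at s 2F ≈ a
    diagonal₀₂-triple {a} a-at =
      let e , e-at , e≤1' , a≤e⨾a = factorˡ a-at (≤-reflexive (sym (⨾-identityˡ a)))
      -- Consistency here means `e ≤ a ⨾ a ˘`, a cycled form of `a ≤ e ⨾ a`.
      in  triple (˘-atom a-at) e-at a-at (cycleˡ a-at e-at a≤e⨾a) , e≤1' , refl , refl

    φ-⨾ : ∀ x y → φʳ (x ⨾ y) ≋ φʳ x ⨟ φʳ y
    φ-⨾ x y = (λ {t} → to {t}) , λ {t} → from {t}
      where
      to : ∀ {t} → proj₁ (φ 𝔄 (x ⨾ y)) t → proj₁ (proj₁ (φʳ x ⨟ φʳ y)) t
      to {t} t₂≤x⨾y =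
        let a , a-at , a≤x , t₂≤a⨾y = factorˡ (isAtom t 2F) t₂≤x⨾y
            b , b-at , b≤y , t₂≤a⨾b = factorʳ (isAtom t 2F) t₂≤a⨾y
            u , u₀≤1' , u₁≈a , u₂≈a = diagonal₁₂-triple a-at
            v , v₁≤1' , v₀≈b˘ , v₂≈b = diagonal₀₂-triple b-at
        -- The middle triple is `(b ˘, a, t₂)`: `u` matches it at index 1, `v` at index 0, and `t`
        -- at index 2.
        in  triple (˘-atom b-at) a-at (isAtom t 2F) (cycleˡ (isAtom t 2F) a-at t₂≤a⨾b)
            , ( (u , (u₀≤1' , ≤-respˡ 𝔄 (sym u₂≈a) a≤x) , sym u₁≈a)
              , (v , (v₁≤1' , ≤-respˡ 𝔄 (sym v₂≈b) b≤y) , sym v₀≈b˘) )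
            , refl

      from : ∀ {t} → proj₁ (proj₁ (φʳ x ⨟ φʳ y)) t → proj₁ (φ 𝔄 (x ⨾ y)) t
      from {t} (s , ((u , (u₀≤1' , u₂≤x) , s₁≈u₁) , (v , (v₁≤1' , v₂≤y) , s₀≈v₀)) , t₂≈s₂) =
        begin
          at t 2F                 ≈⟨ t₂≈s₂ ⟩
          -- Consistency bounds `s₁`; cycling it bounds `s₂` instead.
          at s 2F                 ≤⟨ cycleˡ (isAtom s 1F) (isAtom s 2F) (consistent s) ⟩
          at s 1F ⨾ at s 0F ˘     ≈⟨ ⨾-cong s₁≈u₂ s₀˘≈v₂ ⟩
          at u 2F ⨾ at v 2F       ≤⟨ ⨾-mono u₂≤x v₂≤y ⟩
          x ⨾ y                   ∎
        where
        open PosetReasoning poset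
        s₁≈u₂ : at s 1F ≈ at u 2F
        s₁≈u₂ = trans s₁≈u₁ (belowIdentity₀⇒at₁≈at₂ u u₀≤1')
        s₀˘≈v₂ : at s 0F ˘ ≈ at v 2F
        s₀˘≈v₂ = trans (˘-cong (trans s₀≈v₀ (belowIdentity₁⇒at₀≈at₂˘ v v₁≤1'))) (˘-involutive _)

    -- Along the chain `s`, `u`, `v` the atom `t₂ ˘` travels: it is `s₀`, hence `u₀` and `u₁`, hence
    -- `v₁` and `v₂`, where membership in the image of `x` is tested.
    φ-˘ : ∀ x → φʳ (x ˘) ≋ φʳ x ˘ʳ
    φ-˘ x = (λ {t} → to {t}) , λ {t} → from {t}
      where
      to : ∀ {t} → proj₁ (φ 𝔄 (x ˘)) t → proj₁ (proj₁ (φʳ x ˘ʳ)) t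
      to {t} t₂≤x˘ =
        let s , s₁≤1' , s₀≈t₂˘ , s₂≈t₂ = diagonal₀₂-triple (isAtom t 2F)
            u , u₂≤1' , u₀≈t₂˘ , u₁≈t₂˘ = diagonal₀₁-triple (˘-atom (isAtom t 2F))
            v , v₀≤1' , v₁≈t₂˘ , v₂≈t₂˘ = diagonal₁₂-triple (˘-atom (isAtom t 2F))
        in  s
            , ( s₁≤1'
              , u
              , (u₂≤1' , v , (v₀≤1' , ≤-respˡ 𝔄 (sym v₂≈t₂˘) t₂˘≤x) , trans u₁≈t₂˘ (sym v₁≈t₂˘))
              , trans s₀≈t₂˘ (sym u₀≈t₂˘) )
            , sym s₂≈t₂
        where
        t₂˘≤x : at t 2F ˘ ≤ x
        t₂˘≤x = ≤-trans (˘-mono t₂≤x˘) (≤-reflexive (˘-involutive x))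

      from : ∀ {t} → proj₁ (proj₁ (φʳ x ˘ʳ)) t → proj₁ (φ 𝔄 (x ˘)) t
      from {t} (s , (s₁≤1' , u , (u₂≤1' , v , (v₀≤1' , v₂≤x) , u₁≈v₁) , s₀≈u₀) , t₂≈s₂) =
        ˘-adjoint (begin
          at t 2F ˘   ≈⟨ ˘-cong t₂≈s₂ ⟩
          at s 2F ˘   ≈⟨ belowIdentity₁⇒at₀≈at₂˘ s s₁≤1' ⟨
          at s 0F     ≈⟨ s₀≈u₀ ⟩
          at u 0F     ≈⟨ belowIdentity₂⇒at₁≈at₀ u u₂≤1' ⟨
          at u 1F     ≈⟨ u₁≈v₁ ⟩
          at v 1F     ≈⟨ belowIdentity₀⇒at₁≈at₂ v v₀≤1' ⟩
          at v 2F     ≤⟨ v₂≤x ⟩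
          x           ∎)
        where open PosetReasoning poset

    -- Injectivity and surjectivity.

    φ-reflects-≤ : ∀ {x y} → (∀ {t} → proj₁ (φ 𝔄 x) t → proj₁ (φ 𝔄 y) t) → x ≤ y
    φ-reflects-≤ φx⊆φy = ≤-by-atoms λ a-at a≤x →
      let s , _ , _ , s₂≈a = diagonal₁₂-triple a-at
      in  ≤-respˡ 𝔄 s₂≈a (φx⊆φy {s} (≤-respˡ 𝔄 (sym s₂≈a) a≤x))

    -- The preimage is the supremum of the third components of `X`. An atom `t₂` below it equals one
    -- of these components, and closure of `X` under `T 2F` then gives `t ∈ X`.
    φ-surjective : IsComplete ℓ → (X : RaCarrier) → ∃ λ x → φʳ x ≋ X
    φ-surjective complete ((X , _) , c₂X⊆X , _) = sup
      , (λ {t} t₂≤sup →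
          let _ , (s , s∈X , s₂≈a) , t₂≤a = atom-≤-lub em (isAtom t 2F) sup-lub t₂≤sup
          in  c₂X⊆X (s , s∈X , atom-≤⇒≈ (isAtom t 2F) (isAtom s 2F)
                                (≤-trans t₂≤a (≤-reflexive (sym s₂≈a)))))
      , λ {t} t∈X → proj₁ sup-lub (at t 2F) (t , t∈X , refl)
      where
      third-components : Pred Carrier ℓ
      third-components a = ∃ λ s → X s × at s 2F ≈ a
      sup = proj₁ (complete third-components)
      sup-lub = proj₂ (complete third-components)

theorem5 : ∀ {ℓ} → ExcludedMiddle ℓ →
    (𝔄 : WA ℓ ℓ) → WA.IsComplete 𝔄 ℓ → WA.IsAtomic 𝔄 →
    Σ[ closed ∈ Nr₂-Closed (Cm (suitable 𝔄)) ]
    Σ[ φ∈Nr₂ ∈ (∀ x → φ 𝔄 x ∈ Nr₂ (Cm (suitable 𝔄))) ]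
    IsIsomorphism (WA.raw 𝔄) (Ra (Cm (suitable 𝔄)) closed) (λ x → φ 𝔄 x , φ∈Nr₂ x)
theorem5 em 𝔄 complete atomic = Nr₂-closed 𝔄 , φ∈Nr₂ 𝔄 , record
  { isRelHomomorphism = record { cong = λ x≈y →
      (λ {t} → φ-mono 𝔄 x≈y {t}) , λ {t} → φ-mono 𝔄 (sym x≈y) {t} }
  ; +-homo            = φ-+ 𝔄
  ; ⁻-homo            = φ-⁻ 𝔄
  ; ⨾-homo            = φ-⨾ 𝔄 em atomic
  ; ˘-homo            = φ-˘ 𝔄 em atomic
  -- Both sides are by definition the triples with third component below `1'`.
  ; 1'-homo           = id , id
  ; injective         = λ (φx⊆φy , φy⊆φx) → ≤-antisym
      (φ-reflects-≤ 𝔄 em atomic (λ {t} → φx⊆φy {t}))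
      (φ-reflects-≤ 𝔄 em atomic (λ {t} → φy⊆φx {t}))
  ; surjective        = λ X →
      let x , φx⊆X , X⊆φx = φ-surjective 𝔄 em atomic complete X
      -- Surjectivity over a setoid asks that every `z ≈ x` be sent to `X`.
      in  x , λ z≈x → (λ {t} p → φx⊆X (φ-mono 𝔄 z≈x {t} p))
                    , λ {t} p → φ-mono 𝔄 (sym z≈x) {t} (X⊆φx p)
  }
  where
  open WA 𝔄 using (isEquivalence)
  open IsEquivalence isEquivalence using (sym)
  open WAProperties 𝔄 using (≤-antisym)
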